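{- For every integer $k\ge 6$ there exists a connected graph $G$ with $\mathrm{mpd}(G)=k$.
   Context: Graphs are finite, simple and undirected; $d(u,v)$ denotes the shortest-path distance. Let $G$ be a connected graph and let $\Pi=\{S_1,\dots,S_t\}$ be a partition of $V(G)$ into nonempty parts. For $v\in V(G)$ put $d(v,S_i)=\min\{d(v,x):x\in S_i\}$. The multiset partition representation of $v$ with respect to $\Pi$ is the multiset $r_{mp}(v\mid\Pi)=\{d(v,S_1),\dots,d(v,S_t)\}$ (order ignored, multiplicities kept). $\Pi$ is a resolving multiset partition if $r_{mp}(u\mid\Pi)\ne r_{mp}(v\mid\Pi)$ for all distinct $u,v\in V(G)$. The multiset partition dimension $\mathrm{mpd}(G)$ is the minimum number $t$ of parts of a resolving multiset partition of $G$, and $\mathrm{mpd}(G)=\infty$ if none exists. -}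

module Defs where

open import Data.Fin using (Fin)
open import Data.Fin.Properties using (any?) renaming (_≟_ to _≟ᶠ_)
open import Data.List using (List; tabulate)
open import Data.List.Relation.Binary.Permutation.Propositional using (_↭_)
open import Data.Nat using (ℕ; zero; suc; _≤_; z≤n; s≤s)
open import Data.Nat.Properties using (_≟_)
open import Data.Product using (∃; Σ-syntax; _×_; _,_; proj₁)
open import Function.Definitions using (StrictlySurjective)
open import Level using (0ℓ)
open import Relation.Binary.Core using (Rel)
import Relation.Binary.Definitions as B
open import Relation.Binary.PropositionalEquality using (_≡_; _≢_; refl)
open import Relation.Nullary using (¬_; Dec; yes; no; contradiction)
open import Relation.Nullary.Decidable using (_×-dec_)
open import Relation.Unary using (Pred; Decidable; Satisfiable; _∈_)

IsLeast : Pred ℕ 0ℓ → Pred ℕ 0ℓ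
IsLeast P m = P m × (∀ n → P n → m ≤ n)

least : ∀ {P : Pred ℕ 0ℓ} → Decidable P → ∃ P → ∃ (IsLeast P)
least {P} P? (n , p) = search P? n p
  where
  search : ∀ {P : Pred ℕ 0ℓ} → Decidable P → ∀ n → P n → ∃ (IsLeast P)
  search P? n p with P? 0
  ... | yes p₀ = 0 , p₀ , λ _ _ → z≤n
  search P? zero    p | no ¬p₀ = contradiction p ¬p₀
  search P? (suc n) p | no ¬p₀ with search (λ m → P? (suc m)) n p
  ... | m , pₘ , m≤ = suc m , pₘ , λ where
    zero    q → contradiction q ¬p₀
    (suc j) q → s≤s (m≤ j q)

-- Adjacency is decidable, as it classically always is, so that distances
-- are computable natural numbers.
record Graph : Set₁ where
  field
    order  : ℕ
    Adj    : Rel (Fin order) 0ℓ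
    adj?   : B.Decidable Adj
    sym    : B.Symmetric Adj
    irrefl : B.Irreflexive _≡_ Adj

  Vertex : Set
  Vertex = Fin order

  Walk : ℕ → Rel Vertex 0ℓ
  Walk zero    u v = u ≡ v
  Walk (suc n) u v = ∃ λ w → Adj u w × Walk n w v

  walk? : ∀ n u v → Dec (Walk n u v)
  walk? zero    u v = u ≟ᶠ v
  walk? (suc n) u v = any? λ w → adj? u w ×-dec walk? n w v

  Connected : Set
  Connected = ∀ u v → ∃ λ n → Walk n u v

  -- Parts are indexed only so that they can be listed: S i is the i-th part,
  -- and nonemptiness of all parts is surjectivity of `part`.
  record Partition (t : ℕ) : Set where
    field
      part     : Vertex → Fin t
      nonempty : StrictlySurjective _≡_ part

    S : Fin t → Pred Vertex 0ℓ
    S i x = part x ≡ i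

    S? : ∀ i → Decidable (S i)
    S? i x = part x ≟ᶠ i

  module Metric (connected : Connected) where

    -- A walk of least length is a path, so this is shortest-path distance.
    d : Vertex → Vertex → ℕ
    d u v = proj₁ (least (λ n → walk? n u v) (connected u v))

    dSet : Vertex → (X : Pred Vertex 0ℓ) → Decidable X → Satisfiable X → ℕ
    dSet v X X? (x , x∈X) = proj₁ (least
      {P = λ n → ∃ λ y → y ∈ X × d v y ≡ n}
      (λ n → any? λ y → X? y ×-dec (d v y ≟ n))
      (d v x , x , x∈X , refl))

    -- Multisets are lists up to the permutation relation _↭_.
    rₘₚ : ∀ {t} → Vertex → Partition t → List ℕ
    rₘₚ v Π = tabulate λ i → dSet v (S i) (S? i) (nonempty i)
      where open Partition Π

    Resolving : ∀ {t} → Partition t → Set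
    Resolving Π = ∀ u v → u ≢ v → ¬ (rₘₚ u Π ↭ rₘₚ v Π)

    -- `mpd≡ k` says that mpd is the finite number k; mpd is ∞ exactly when
    -- no resolving partition exists, and then `mpd≡ k` fails for every k.
    mpd≡_ : ℕ → Set
    mpd≡ k = IsLeast (λ t → Σ[ Π ∈ Partition t ] Resolving Π) k

{-# OPTIONS --safe #-}

-- Let m = k - 1.  The graph consists of vertices w₀, …, w₍ₘ₋₁₎, a path
-- z – z₁ – h, and two further vertices h′ and c; both h and h′ are joined to
-- every wᵢ, h′ is joined to c, c is joined to wᵢ iff 2i > m, and wᵢ to wⱼ
-- (i ≠ j) iff i + j > m.
--
-- Upper bound: put z in a part of its own, wⱼ in part j, c in part 1 and h, h′
-- and z₁ in part 0.  Then wᵢ has distance 1 to exactly i parts: part 0 if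
-- i ≥ 1, and the i - 1 parts j with i + j > m, where c in part 1 makes up for
-- j = i when 2i > m.  The numbers of 4s, 3s and 1s in its multiset then
-- identify every vertex.
--
-- Lower bound: every wᵢ and c are within distance 2 of h, h′, c and all wⱼ,
-- while the distances from wᵢ to z and z₁ do not depend on i.  If all t parts
-- meet {h, h′, c, wⱼ}, the multisets of the m + 1 vertices c, wᵢ consist of one
-- 0, some 1s and some 2s, so they are distinguished by at most t numbers of 1s.
-- If a part is missed, its distance from each wᵢ is at least 2, so the m
-- vertices wᵢ are distinguished by at most t - 1 numbers of 1s.  Either way
-- t ≥ m + 1.
module Submission where

open import Defs
open import Algebra.Properties.CommutativeMonoid.Sum using (sum; sum-cong-≗; ∑-distrib-+)
open import Data.Bool using (if_then_else_; true; false; T)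
open import Data.Empty using (⊥)
open import Data.Fin using (Fin; zero; suc; toℕ; fromℕ; fromℕ<; _↑ʳ_)
open import Data.Fin.Properties
  using (all?; any?; pigeonhole; fromℕ<-injective; toℕ-injective; toℕ<n; toℕ-fromℕ;
    ↑ʳ-injective; ¬∀⟶∃¬; nonZeroIndex)
  renaming (_≟_ to _≟ᶠ_; <⇒≢ to <ᶠ⇒≢)
open import Data.List using (List; []; _∷_; _++_; tabulate; map)
open import Data.List.Membership.Propositional using () renaming (_∈_ to _∈ˡ_)
open import Data.List.Membership.Propositional.Properties using (∈-∃++)
open import Data.List.Relation.Binary.Permutation.Propositional
  using (_↭_; refl; prep; ↭-sym; ↭-trans)
open import Data.List.Relation.Binary.Permutation.Propositional.Properties using (map⁺; shift)
open import Data.List.Relation.Unary.Any using (here; there)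
open import Data.Maybe using (Maybe; just; nothing; maybe)
open import Data.Nat
open import Data.Nat.ListAction using () renaming (sum to sumˡ)
open import Data.Nat.ListAction.Properties using (sum-↭)
open import Data.Nat.Properties
open import Algebra.Properties.Semiring.Sum +-*-semiring using (*-distribʳ-sum)
open import Data.Product using (∃; Σ-syntax; _×_; _,_; proj₁; proj₂)
open import Data.Sum using (_⊎_; inj₁; inj₂; [_,_]′)
open import Data.Unit using (tt)
open import Function using (_∘_)
open import Relation.Binary.PropositionalEquality
  using (_≡_; _≢_; refl; sym; trans; cong; cong₂; subst; module ≡-Reasoning)
open import Relation.Nullary using (¬_; Dec; yes; no; contradiction; does)
open import Relation.Nullary.Decidable using (_×-dec_; toSum)

-- Finite sums and multiplicities in lists of numbers.

∑ : ∀ {n} → (Fin n → ℕ) → ℕ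
∑ = sum +-0-commutativeMonoid

∑-cong : ∀ {n} {f g : Fin n → ℕ} → (∀ i → f i ≡ g i) → ∑ f ≡ ∑ g
∑-cong = sum-cong-≗ +-0-commutativeMonoid

∑-+ : ∀ {n} (f g : Fin n → ℕ) → ∑ (λ i → f i + g i) ≡ ∑ f + ∑ g
∑-+ = ∑-distrib-+ +-0-commutativeMonoid

∑-const : ∀ n c → ∑ {n} (λ _ → c) ≡ n * c
∑-const zero    c = refl
∑-const (suc n) c = cong (c +_) (∑-const n c)

∑-zero : ∀ {n} {f : Fin n → ℕ} → (∀ i → f i ≡ 0) → ∑ f ≡ 0
∑-zero {n} f≡0 = trans (∑-cong f≡0) (trans (∑-const n 0) (*-zeroʳ n))

∑≤n : ∀ {n} (f : Fin n → ℕ) → (∀ i → f i ≤ 1) → ∑ f ≤ n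
∑≤n {zero}  f f≤1 = z≤n
∑≤n {suc n} f f≤1 = +-mono-≤ (f≤1 zero) (∑≤n (f ∘ suc) (f≤1 ∘ suc))

term≤∑ : ∀ {n} (f : Fin n → ℕ) i → f i ≤ ∑ f
term≤∑ f zero    = m≤m+n _ _
term≤∑ f (suc i) = ≤-trans (term≤∑ (f ∘ suc) i) (m≤n+m _ _)

-- Kronecker delta, recursive in both arguments so that it computes on numerals and under common
-- successors.
δ : ℕ → ℕ → ℕ
δ zero    zero    = 1
δ zero    (suc _) = 0
δ (suc _) zero    = 0
δ (suc x) (suc y) = δ x y

δ-refl : ∀ x → δ x x ≡ 1
δ-refl zero    = refl
δ-refl (suc x) = δ-refl x

δ-≢ : ∀ {x y} → x ≢ y → δ x y ≡ 0
δ-≢ {zero}  {zero}  x≢y = contradiction refl x≢y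
δ-≢ {zero}  {suc y} x≢y = refl
δ-≢ {suc x} {zero}  x≢y = refl
δ-≢ {suc x} {suc y} x≢y = δ-≢ (x≢y ∘ cong suc)

δ-≤1 : ∀ x y → δ x y ≤ 1
δ-≤1 zero    zero    = ≤-refl
δ-≤1 zero    (suc _) = z≤n
δ-≤1 (suc _) zero    = z≤n
δ-≤1 (suc x) (suc y) = δ-≤1 x y

δ-large : ∀ {x n} → n ≤ 2 → δ (3 + x) n ≡ 0
δ-large {n = 0} _ = refl
δ-large {n = 1} _ = refl
δ-large {n = 2} _ = refl
δ-large {n = suc (suc (suc n))} (s≤s (s≤s ()))

∑-δ : ∀ {n} (i : Fin n) → ∑ {n} (λ j → δ (toℕ i) (toℕ j)) ≡ 1
∑-δ {suc n} zero    = cong suc (trans (∑-const n 0) (*-zeroʳ n))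
∑-δ         (suc i) = ∑-δ i

∑-δ-* : ∀ {n} (i : Fin n) b → ∑ {n} (λ j → δ (toℕ i) (toℕ j) * b) ≡ b
∑-δ-* {n} i b = trans (sym (*-distribʳ-sum {n} b (λ j → δ (toℕ i) (toℕ j))))
  (trans (cong (_* b) (∑-δ i)) (*-identityˡ b))

count : ℕ → List ℕ → ℕ
count x ys = sumˡ (map (δ x) ys)

count-tabulate : ∀ x {n} (f : Fin n → ℕ) → count x (tabulate f) ≡ ∑ (δ x ∘ f)
count-tabulate x {zero}  f = refl
count-tabulate x {suc n} f = cong (δ x (f zero) +_) (count-tabulate x (f ∘ suc))

count-↭ : ∀ x {ys zs} → ys ↭ zs → count x ys ≡ count x zs
count-↭ x p = sum-↭ (map⁺ (δ x) p)

count>0⇒∈ : ∀ x ys → 0 < count x ys → x ∈ˡ ys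
count>0⇒∈ x (y ∷ ys) 0< with x ≟ y
... | yes x≡y = here x≡y
... | no  x≢y = there (count>0⇒∈ x ys (subst (λ n → 0 < n + count x ys) (δ-≢ x≢y) 0<))

-- The head `x` has positive multiplicity in `ys`, so `ys` splits around an occurrence of it;
-- removing that occurrence from both lists preserves the hypothesis.
count-≡⇒↭ : ∀ xs ys → (∀ x → count x xs ≡ count x ys) → xs ↭ ys
count-≡⇒↭ [] [] eq = refl
count-≡⇒↭ [] (y ∷ ys) eq =
  contradiction (trans (eq y) (cong (_+ count y ys) (δ-refl y))) λ()
count-≡⇒↭ (x ∷ xs) ys eq
  with as , bs , refl ← ∈-∃++ (count>0⇒∈ x ys
    (subst (0 <_) (eq x) (subst (λ n → 0 < n + count x xs) (sym (δ-refl x)) z<s)))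
  = ↭-trans (prep x (count-≡⇒↭ xs (as ++ bs) λ y →
      +-cancelˡ-≡ (δ y x) _ _ (trans (eq y) (count-↭ y (shift x as bs)))))
    (↭-sym (shift x as bs))

-- Distances to parts in an arbitrary connected graph.

module _ (G : Graph) (connected : Graph.Connected G) where
  open Graph G using (Vertex; Walk; walk?; Partition; module Metric)
  open Metric connected

  d-isLeast : ∀ u v → IsLeast (λ n → Walk n u v) (d u v)
  d-isLeast u v = proj₂ (least (λ n → walk? n u v) (connected u v))

  d-refl : ∀ v → d v v ≡ 0
  d-refl v = n≤0⇒n≡0 (proj₂ (d-isLeast v v) 0 refl)

  d≡0⇒≡ : ∀ {u v} → d u v ≡ 0 → u ≡ v
  d≡0⇒≡ {u} {v} eq = subst (λ n → Walk n u v) eq (proj₁ (d-isLeast u v))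

  module _ {t} (Π : Partition t) where
    open Partition Π

    -- Opaque, since the search behind `least` would otherwise be unfolded on
    -- concrete graphs.
    opaque
      r : Vertex → Fin t → ℕ
      r v p = dSet v (S p) (S? p) (nonempty p)

      r-isLeast : ∀ v p → IsLeast (λ n → ∃ λ y → part y ≡ p × d v y ≡ n) (r v p)
      r-isLeast v p = proj₂ (least
        {P = λ n → ∃ λ y → part y ≡ p × d v y ≡ n}
        (λ n → any? λ y → S? p y ×-dec (d v y ≟ n))
        (d v (proj₁ (nonempty p)) , proj₁ (nonempty p) , proj₂ (nonempty p) , refl))

      rₘₚ-tabulate : ∀ v → rₘₚ v Π ≡ tabulate (r v)
      rₘₚ-tabulate v = refl

    r≤d : ∀ v y → r v (part y) ≤ d v y
    r≤d v y = proj₂ (r-isLeast v (part y)) (d v y) (y , refl , refl)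

    r-greatest : ∀ v p {n} → (∀ y → part y ≡ p → n ≤ d v y) → n ≤ r v p
    r-greatest v p {n} n≤ with y , y∈p , eq ← proj₁ (r-isLeast v p)
      = subst (n ≤_) eq (n≤ y y∈p)

    r-mono : ∀ u v p → (∀ y → part y ≡ p → d u y ≤ d v y) → r u p ≤ r v p
    r-mono u v p d≤ = r-greatest v p λ { y refl → ≤-trans (r≤d u y) (d≤ y refl) }

    -- Certifies a closed formula `R` for the distances to parts without evaluating any minimum.
    r≡ : ∀ v {R : Fin t → ℕ} → (∀ y → R (part y) ≤ d v y) →
         (∀ p → ∃ λ y → part y ≡ p × d v y ≡ R p) → ∀ p → r v p ≡ R p
    r≡ v {R} lower attained p with y , refl , eq ← attained p = ≤-antisym
      (subst (r v p ≤_) eq (r≤d v y))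
      (r-greatest v p λ y′ eq′ → subst (λ q → R q ≤ d v y′) eq′ (lower y′))

    -- Distance 0 occurs for the part of `v` and for no other; writing this with `δ` lets `∑-δ`
    -- count the zeros.
    r-δ : ∀ v p → δ 0 (r v p) ≡ δ (toℕ (part v)) (toℕ p)
    r-δ v p with part v ≟ᶠ p
    ... | yes refl rewrite n≤0⇒n≡0 (subst (r v (part v) ≤_) (d-refl v) (r≤d v v))
          = sym (δ-refl (toℕ (part v)))
    ... | no ≢p = trans (δ-≢ (≢p ∘ r≡0⇒ ∘ sym)) (sym (δ-≢ (≢p ∘ toℕ-injective)))
      where
      r≡0⇒ : r v p ≡ 0 → part v ≡ p
      r≡0⇒ eq with y , y∈p , d≡r ← proj₁ (r-isLeast v p)
        = trans (cong part (d≡0⇒≡ (trans d≡r eq))) y∈p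

    occ : ℕ → Vertex → ℕ
    occ x v = ∑ (δ x ∘ r v)

    occ-0 : ∀ v → occ 0 v ≡ 1
    occ-0 v = trans (∑-cong (r-δ v)) (∑-δ (part v))

    -- The part of `v` itself contributes a 0, hence no 1.
    occ-1-< : ∀ v → occ 1 v < t
    occ-1-< v = begin
      suc (occ 1 v)                      ≡⟨ cong (_+ occ 1 v) (occ-0 v) ⟨
      occ 0 v + occ 1 v                  ≡⟨ ∑-+ (δ 0 ∘ r v) (δ 1 ∘ r v) ⟨
      ∑ (λ p → δ 0 (r v p) + δ 1 (r v p)) ≤⟨ ∑≤n _ (λ p → δ₀₁≤1 (r v p)) ⟩
      t                                  ∎
      where
      open ≤-Reasoning
      δ₀₁≤1 : ∀ n → δ 0 n + δ 1 n ≤ 1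
      δ₀₁≤1 0 = ≤-refl
      δ₀₁≤1 1 = ≤-refl
      δ₀₁≤1 (suc (suc n)) = z≤n

    -- Two different parts contribute no 1: the part of `v`, and `p`.
    occ-1-far : ∀ v p → 2 ≤ r v p → suc (occ 1 v) < t
    occ-1-far v p 2≤ = begin
      2 + occ 1 v ≡⟨ cong (λ n → suc n + occ 1 v) (occ-0 v) ⟨
      suc (occ 0 v + occ 1 v) ≡⟨ cong suc (∑-+ (δ 0 ∘ r v) (δ 1 ∘ r v)) ⟨
      suc (∑ (λ q → δ 0 (r v q) + δ 1 (r v q)))
        ≤⟨ +-monoˡ-≤ _ (≤-trans (≤-reflexive (sym (big-≥2 2≤))) (term≤∑ (big ∘ r v) p)) ⟩
      ∑ (big ∘ r v) + ∑ (λ q → δ 0 (r v q) + δ 1 (r v q))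
        ≡⟨ ∑-+ (big ∘ r v) (λ q → δ 0 (r v q) + δ 1 (r v q)) ⟨
      ∑ (λ q → big (r v q) + (δ 0 (r v q) + δ 1 (r v q)))
        ≤⟨ ∑≤n _ (λ q → total (r v q)) ⟩
      t ∎
      where
      open ≤-Reasoning
      big : ℕ → ℕ
      big (suc (suc n)) = 1
      big _ = 0
      big-≥2 : ∀ {n} → 2 ≤ n → big n ≡ 1
      big-≥2 (s≤s (s≤s _)) = refl
      total : ∀ n → big n + (δ 0 n + δ 1 n) ≤ 1
      total 0 = ≤-refl
      total 1 = ≤-refl
      total (suc (suc n)) = ≤-refl

    count-rₘₚ : ∀ x v → count x (rₘₚ v Π) ≡ occ x v
    count-rₘₚ x v = trans (cong (count x) (rₘₚ-tabulate v)) (count-tabulate x (r v))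

    -- All multiplicities agree: 0 occurs once on both sides, values above 2 occur in the same
    -- positions, and the number of 2s follows because equally many entries are at most 2.
    rₘₚ-↭ : ∀ u v → (∀ p → r u p ≡ r v p ⊎ (r u p ≤ 2 × r v p ≤ 2)) →
            occ 1 u ≡ occ 1 v → rₘₚ u Π ↭ rₘₚ v Π
    rₘₚ-↭ u v close eq₁ = count-≡⇒↭ _ _ λ x →
      trans (count-rₘₚ x u) (trans (occ-≡ x) (sym (count-rₘₚ x v)))
      where
      small : ℕ → ℕ
      small n = δ 0 n + (δ 1 n + δ 2 n)

      small-≤2 : ∀ {n} → n ≤ 2 → small n ≡ 1
      small-≤2 {0} _ = refl
      small-≤2 {1} _ = refl
      small-≤2 {2} _ = refl
      small-≤2 {suc (suc (suc n))} (s≤s (s≤s ()))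

      ∑-small : ∀ w → ∑ (small ∘ r w) ≡ occ 0 w + (occ 1 w + occ 2 w)
      ∑-small w = trans (∑-+ (δ 0 ∘ r w) _) (cong (occ 0 w +_) (∑-+ (δ 1 ∘ r w) (δ 2 ∘ r w)))

      small-≡ : ∀ p → small (r u p) ≡ small (r v p)
      small-≡ p with close p
      ... | inj₁ eq      = cong small eq
      ... | inj₂ (a , b) = trans (small-≤2 a) (sym (small-≤2 b))

      large-≡ : ∀ x p → δ (3 + x) (r u p) ≡ δ (3 + x) (r v p)
      large-≡ x p with close p
      ... | inj₁ eq      = cong (δ (3 + x)) eq
      ... | inj₂ (a , b) = trans (δ-large {x} a) (sym (δ-large {x} b))

      occ-≡ : ∀ x → occ x u ≡ occ x v
      occ-≡ 0 = trans (occ-0 u) (sym (occ-0 v))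
      occ-≡ 1 = eq₁
      occ-≡ 2 = +-cancelˡ-≡ (occ 1 u) _ _ (+-cancelˡ-≡ (occ 0 u) _ _ (begin
        occ 0 u + (occ 1 u + occ 2 u) ≡⟨ ∑-small u ⟨
        ∑ (small ∘ r u)               ≡⟨ ∑-cong small-≡ ⟩
        ∑ (small ∘ r v)               ≡⟨ ∑-small v ⟩
        occ 0 v + (occ 1 v + occ 2 v) ≡⟨ cong₂ (λ a b → a + (b + occ 2 v)) (occ-≡ 0) eq₁ ⟨
        occ 0 u + (occ 1 u + occ 2 v) ∎))
        where open ≡-Reasoning
      occ-≡ (suc (suc (suc x))) = ∑-cong (large-≡ x)

    occ-cong : ∀ {u v} → rₘₚ u Π ↭ rₘₚ v Π → ∀ x → occ x u ≡ occ x v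
    occ-cong {u} {v} p x =
      trans (sym (count-rₘₚ x u)) (trans (count-↭ x p) (count-rₘₚ x v))

-- The graph and its distance function.

module Construction (a : ℕ) where
  -- m ≥ 4 keeps the number of 1s of c below that of h′.
  m : ℕ
  m = 4 + a

  V : Set
  V = Fin (5 + m)

  pattern z   = zero
  pattern z₁  = suc zero
  pattern h   = suc (suc zero)
  pattern h′  = suc (suc (suc zero))
  pattern c   = suc (suc (suc (suc zero)))
  pattern w i = suc (suc (suc (suc (suc i))))

  -- The threshold rule for distances: `s` is `i + j` for `w i` and `w j` with `i ≢ j`, and `i + i`
  -- for `c` and `w i`.
  near : ℕ → ℕ
  near s = if m <ᵇ s then 1 else 2

  near-≥1 : ∀ s → 1 ≤ near s
  near-≥1 s with m <ᵇ s
  ... | true  = ≤-refl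
  ... | false = s≤s z≤n

  near-≤2 : ∀ s → near s ≤ 2
  near-≤2 s with m <ᵇ s
  ... | true  = s≤s z≤n
  ... | false = ≤-refl

  near≢0 : ∀ s → near s ≢ 0
  near≢0 s eq = contradiction (subst (1 ≤_) eq (near-≥1 s)) λ()

  near-close : ∀ {s} → m < s → near s ≡ 1
  near-close {s} m<s with m <ᵇ s | <⇒<ᵇ m<s
  ... | true | _ = refl

  near-distant : ∀ {s} → s ≤ m → near s ≡ 2
  near-distant {s} s≤m with m <ᵇ s in eq
  ... | false = refl
  ... | true  = contradiction (<ᵇ⇒< m s (subst T (sym eq) tt)) (≤⇒≯ s≤m)

  near-cases : ∀ s → near s ≡ 1 ⊎ near s ≡ 2
  near-cases s with m <ᵇ s
  ... | true  = inj₁ refl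
  ... | false = inj₂ refl

  distʷ : Fin m → Fin m → ℕ
  distʷ i j = if does (i ≟ᶠ j) then 0 else near (toℕ i + toℕ j)

  distʷ-≤2 : ∀ i j → distʷ i j ≤ 2
  distʷ-≤2 i j with does (i ≟ᶠ j)
  ... | true  = z≤n
  ... | false = near-≤2 (toℕ i + toℕ j)

  distʷ-refl : ∀ i → distʷ i i ≡ 0
  distʷ-refl i with i ≟ᶠ i
  ... | yes _   = refl
  ... | no  i≢i = contradiction refl i≢i

  distʷ≡0⇒≡ : ∀ i j → distʷ i j ≡ 0 → i ≡ j
  distʷ≡0⇒≡ i j eq with i ≟ᶠ j
  ... | yes i≡j = i≡j
  ... | no  _   = contradiction eq (near≢0 (toℕ i + toℕ j))

  distʷ-≢ : ∀ i j → i ≢ j → distʷ i j ≡ near (toℕ i + toℕ j)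
  distʷ-≢ i j i≢j with i ≟ᶠ j
  ... | yes i≡j = contradiction i≡j i≢j
  ... | no  _   = refl

  distʷ-sym : ∀ i j → distʷ i j ≡ distʷ j i
  distʷ-sym i j with i ≟ᶠ j | j ≟ᶠ i
  ... | yes _   | yes _   = refl
  ... | yes i≡j | no  j≢i = contradiction (sym i≡j) j≢i
  ... | no  i≢j | yes j≡i = contradiction (sym j≡i) i≢j
  ... | no  _   | no  _   = cong near (+-comm (toℕ i) (toℕ j))

  ℓ : V → ℕ
  ℓ z     = 0
  ℓ z₁    = 1
  ℓ h     = 2
  ℓ h′    = 4
  ℓ c     = 4
  ℓ (w i) = 3

  -- The pairs whose distance is not the difference of their distances ℓ to z;
  -- the two bounds make the distance lower bounds uniform over all pairs.
  shortDist : ∀ u v → Maybe (∃ (_≤ 2) × ∣ ℓ u - ℓ v ∣ ≤ 1)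
  shortDist h′    c     = just ((1 , s≤s z≤n) , z≤n)
  shortDist c     h′    = just ((1 , s≤s z≤n) , z≤n)
  shortDist c     (w i) = just ((near (toℕ i + toℕ i) , near-≤2 (toℕ i + toℕ i)) , s≤s z≤n)
  shortDist (w i) c     = just ((near (toℕ i + toℕ i) , near-≤2 (toℕ i + toℕ i)) , s≤s z≤n)
  shortDist (w i) (w j) = just ((distʷ i j , distʷ-≤2 i j) , z≤n)
  shortDist _     _     = nothing

  dist : V → V → ℕ
  dist u v = maybe (proj₁ ∘ proj₁) ∣ ℓ u - ℓ v ∣ (shortDist u v)

  dist-bound : ∀ u v {n} → 2 ≤ n → ∣ ℓ u - ℓ v ∣ ≤ n → dist u v ≤ n
  dist-bound u v 2≤n ≤n with shortDist u v
  ... | just ((_ , ≤2) , _) = ≤-trans ≤2 2≤n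
  ... | nothing       = ≤n

  dist-refl : ∀ v → dist v v ≡ 0
  dist-refl z     = refl
  dist-refl z₁    = refl
  dist-refl h     = refl
  dist-refl h′    = refl
  dist-refl c     = refl
  dist-refl (w i) = distʷ-refl i

  dist-sym : ∀ u v → dist u v ≡ dist v u
  dist-sym z z         = refl
  dist-sym z z₁        = refl
  dist-sym z h         = refl
  dist-sym z h′        = refl
  dist-sym z c         = refl
  dist-sym z (w i)     = refl
  dist-sym z₁ z        = refl
  dist-sym z₁ z₁       = refl
  dist-sym z₁ h        = refl
  dist-sym z₁ h′       = refl
  dist-sym z₁ c        = refl
  dist-sym z₁ (w i)    = refl
  dist-sym h z         = refl
  dist-sym h z₁        = refl
  dist-sym h h         = refl
  dist-sym h h′        = refl
  dist-sym h c         = refl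
  dist-sym h (w i)     = refl
  dist-sym h′ z        = refl
  dist-sym h′ z₁       = refl
  dist-sym h′ h        = refl
  dist-sym h′ h′       = refl
  dist-sym h′ c        = refl
  dist-sym h′ (w i)    = refl
  dist-sym c z         = refl
  dist-sym c z₁        = refl
  dist-sym c h         = refl
  dist-sym c h′        = refl
  dist-sym c c         = refl
  dist-sym c (w i)     = refl
  dist-sym (w i) z     = refl
  dist-sym (w i) z₁    = refl
  dist-sym (w i) h     = refl
  dist-sym (w i) h′    = refl
  dist-sym (w i) c     = refl
  dist-sym (w i) (w j) = distʷ-sym i j

  -- Along an edge `ℓ` changes by at most 1, so a walk is at least as long as the difference of `ℓ`
  -- at its ends.
  dist≡1⇒ℓ : ∀ u v → dist u v ≡ 1 → ∣ ℓ u - ℓ v ∣ ≤ 1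
  dist≡1⇒ℓ u v eq with shortDist u v
  ... | just (_ , ≤1) = ≤1
  ... | nothing       = ≤-reflexive eq

  G : Graph
  G = record
    { order  = 5 + m
    -- Edges are read off from the intended distance function; `d≡dist` confirms that it is the
    -- distance of the resulting graph.
    ; Adj    = λ u v → dist u v ≡ 1
    ; adj?   = λ u v → dist u v ≟ 1
    ; sym    = λ {u} {v} eq → trans (dist-sym v u) eq
    ; irrefl = λ { {u} refl eq → contradiction (trans (sym (dist-refl u)) eq) λ() }
    }

  open Graph G using (Walk)

  walk-ℓ : ∀ n {u v} → Walk n u v → ∣ ℓ u - ℓ v ∣ ≤ n
  walk-ℓ zero    {u} refl             = ≤-reflexive (∣n-n∣≡0 (ℓ u))
  walk-ℓ (suc n) {u} {v} (x , ux , p) = ≤-trans (∣-∣-triangle (ℓ u) (ℓ x) (ℓ v))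
    (+-mono-≤ (dist≡1⇒ℓ u x ux) (walk-ℓ n {x} {v} p))

  -- Lengths 0 and 1 are equality and adjacency. From length 2 on, the exceptional pairs satisfy the
  -- bound trivially and all others are governed by `ℓ`.
  dist-≤-walk : ∀ n {u v} → Walk n u v → dist u v ≤ n
  dist-≤-walk 0 {u} refl = ≤-reflexive (dist-refl u)
  dist-≤-walk 1 (x , ux , refl) = ≤-reflexive ux
  dist-≤-walk n@(suc (suc _)) {u} {v} p = dist-bound u v (s≤s (s≤s z≤n)) (walk-ℓ n {u} {v} p)

  via : ∀ n {u v} x → n ≡ 1 ⊎ n ≡ 2 → (n ≡ 1 → dist u v ≡ 1) → dist u x ≡ 1 → dist x v ≡ 1 → Walk n u v
  via .1 x (inj₁ refl) uv ux xv = _ , uv refl , refl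
  via .2 x (inj₂ refl) uv ux xv = x , ux , _ , xv , refl

  -- The largest index `m - 1`: since `2 (m - 1) > m`, this vertex joins `c` to `h`.
  last : Fin m
  last = fromℕ (3 + a)

  last-c : near (toℕ last + toℕ last) ≡ 1
  last-c = near-close (subst (λ i → m < i + i) (sym (toℕ-fromℕ (3 + a)))
    (+-monoʳ-≤ 3 (≤-trans (≤-reflexive (+-comm 2 a)) (+-monoʳ-≤ a (s≤s (s≤s z≤n))))))

  walk : ∀ u v → Walk (dist u v) u v
  walk z z      = refl
  walk z z₁     = z₁ , refl , refl
  walk z h      = z₁ , refl , h , refl , refl
  walk z h′     = z₁ , refl , h , refl , w zero , refl , h′ , refl , refl
  walk z c      = z₁ , refl , h , refl , w last , refl , c , last-c , refl
  walk z (w i)  = z₁ , refl , h , refl , w i , refl , refl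
  walk z₁ z     = z , refl , refl
  walk z₁ z₁    = refl
  walk z₁ h     = h , refl , refl
  walk z₁ h′    = h , refl , w zero , refl , h′ , refl , refl
  walk z₁ c     = h , refl , w last , refl , c , last-c , refl
  walk z₁ (w i) = h , refl , w i , refl , refl
  walk h z      = z₁ , refl , z , refl , refl
  walk h z₁     = z₁ , refl , refl
  walk h h      = refl
  walk h h′     = w zero , refl , h′ , refl , refl
  walk h c      = w last , refl , c , last-c , refl
  walk h (w i)  = w i , refl , refl
  walk h′ z     = w zero , refl , h , refl , z₁ , refl , z , refl , refl
  walk h′ z₁    = w zero , refl , h , refl , z₁ , refl , refl
  walk h′ h     = w zero , refl , h , refl , refl
  walk h′ h′    = refl
  walk h′ c     = c , refl , refl
  walk h′ (w i) = w i , refl , refl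
  walk c z      = w last , last-c , h , refl , z₁ , refl , z , refl , refl
  walk c z₁     = w last , last-c , h , refl , z₁ , refl , refl
  walk c h      = w last , last-c , h , refl , refl
  walk c h′     = h′ , refl , refl
  walk c c      = refl
  walk c (w i)  = via _ h′ (near-cases (toℕ i + toℕ i)) (λ eq → eq) refl refl
  walk (w i) z  = h , refl , z₁ , refl , z , refl , refl
  walk (w i) z₁ = h , refl , z₁ , refl , refl
  walk (w i) h  = h , refl , refl
  walk (w i) h′ = h′ , refl , refl
  walk (w i) c  = via _ h′ (near-cases (toℕ i + toℕ i)) (λ eq → eq) refl refl
  walk (w i) (w j) with distʷ i j in eq | distʷ-≤2 i j
  ... | 0 | _ = cong (5 ↑ʳ_) (distʷ≡0⇒≡ i j eq)
  ... | 1 | _ = w j , eq , refl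
  ... | 2 | _ = h , refl , w j , refl , refl
  ... | suc (suc (suc _)) | s≤s (s≤s ())

  connected : Graph.Connected G
  connected u v = dist u v , walk u v

  open Graph.Metric G connected

  d≡dist : ∀ u v → d u v ≡ dist u v
  d≡dist u v with isWalk , minimal ← d-isLeast G connected u v
    = ≤-antisym (minimal (dist u v) (walk u v)) (dist-≤-walk (d u v) isWalk)

  -- The partition into `suc m` parts and its distance vectors.

  -- `zero` is the part of z and `suc j` is part j of the introduction.
  part : V → Fin (suc m)
  part z     = zero
  part z₁    = suc zero
  part h     = suc zero
  part h′    = suc zero
  part c     = suc (suc zero)
  part (w j) = suc j

  open Graph G using (Partition)

  Π : Partition (suc m)
  Π = record
    { part     = part
    ; nonempty = λ { zero → z , refl ; (suc j) → w j , refl }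
    }

  -- Meant for `i ≢ j`. Part 0 is reached at `h` or `h′`, part 1 at `c`, because `w₁` is at distance
  -- 2 from every other `wᵢ`; each remaining part is a single `wⱼ`.
  repʷ : Fin m → Fin m → ℕ
  repʷ i zero            = 1
  repʷ i (suc zero)      = near (toℕ i + toℕ i)
  repʷ i j@(suc (suc _)) = near (toℕ i + toℕ j)

  rep : V → Fin (suc m) → ℕ
  rep z     zero                  = 0
  rep z     (suc zero)            = 1
  rep z     (suc (suc j))         = 3
  rep z₁    zero                  = 1
  rep z₁    (suc zero)            = 0
  rep z₁    (suc (suc j))         = 2
  rep h     zero                  = 2
  rep h     (suc zero)            = 0
  rep h     (suc (suc j))         = 1
  rep h′    zero                  = 4
  rep h′    (suc zero)            = 0
  rep h′    (suc (suc j))         = 1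
  rep c     zero                  = 4
  rep c     (suc zero)            = 1
  rep c     (suc (suc zero))      = 0
  rep c     (suc j@(suc (suc _))) = near (toℕ j + toℕ j)
  rep (w i) zero                  = 3
  rep (w i) (suc j)               = if does (i ≟ᶠ j) then 0 else repʷ i j

  repʷ-≤2 : ∀ i j → repʷ i j ≤ 2
  repʷ-≤2 i zero            = s≤s z≤n
  repʷ-≤2 i (suc zero)      = near-≤2 (toℕ i + toℕ i)
  repʷ-≤2 i j@(suc (suc _)) = near-≤2 (toℕ i + toℕ j)

  near-+1 : ∀ (i : Fin m) → near (toℕ i + 1) ≡ 2
  near-+1 i = near-distant (≤-trans (≤-reflexive (+-comm (toℕ i) 1)) (toℕ<n i))

  near-+0 : ∀ (i : Fin m) → near (toℕ i + 0) ≡ 2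
  near-+0 i = near-distant (≤-trans (≤-reflexive (+-identityʳ (toℕ i))) (<⇒≤ (toℕ<n i)))

  rep-lower : ∀ v y → rep v (part y) ≤ dist v y
  rep-lower z z                 = z≤n
  rep-lower z z₁                = s≤s z≤n
  rep-lower z h                 = s≤s z≤n
  rep-lower z h′                = s≤s z≤n
  rep-lower z c                 = n≤1+n 3
  rep-lower z (w zero)          = s≤s z≤n
  rep-lower z (w (suc _))       = ≤-refl
  rep-lower z₁ z                = ≤-refl
  rep-lower z₁ z₁               = z≤n
  rep-lower z₁ h                = z≤n
  rep-lower z₁ h′               = z≤n
  rep-lower z₁ c                = n≤1+n 2
  rep-lower z₁ (w zero)         = z≤n
  rep-lower z₁ (w (suc _))      = ≤-refl
  rep-lower h z                 = ≤-refl
  rep-lower h z₁                = z≤n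
  rep-lower h h                 = z≤n
  rep-lower h h′                = z≤n
  rep-lower h c                 = n≤1+n 1
  rep-lower h (w zero)          = z≤n
  rep-lower h (w (suc _))       = ≤-refl
  rep-lower h′ z                = ≤-refl
  rep-lower h′ z₁               = z≤n
  rep-lower h′ h                = z≤n
  rep-lower h′ h′               = z≤n
  rep-lower h′ c                = ≤-refl
  rep-lower h′ (w zero)         = z≤n
  rep-lower h′ (w (suc _))      = ≤-refl
  rep-lower c z                 = ≤-refl
  rep-lower c z₁                = s≤s z≤n
  rep-lower c h                 = s≤s z≤n
  rep-lower c h′                = ≤-refl
  rep-lower c c                 = z≤n
  rep-lower c (w zero)          = s≤s z≤n
  rep-lower c (w (suc zero))    = z≤n
  rep-lower c (w (suc (suc _))) = ≤-refl
  rep-lower (w i) z             = ≤-refl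
  rep-lower (w zero) z₁         = z≤n
  rep-lower (w (suc _)) z₁      = s≤s z≤n
  rep-lower (w zero) h          = z≤n
  rep-lower (w (suc _)) h       = ≤-refl
  rep-lower (w zero) h′         = z≤n
  rep-lower (w (suc _)) h′      = ≤-refl
  rep-lower (w zero) c          = ≤-refl
  rep-lower (w (suc zero)) c    = z≤n
  rep-lower (w (suc (suc _))) c = ≤-refl
  rep-lower (w i) (w j) with does (i ≟ᶠ j)
  ... | true  = z≤n
  ... | false = lower j
    where
    lower : ∀ j → repʷ i j ≤ near (toℕ i + toℕ j)
    lower zero          = near-≥1 (toℕ i + 0)
    lower (suc zero)    = subst (near (toℕ i + toℕ i) ≤_) (sym (near-+1 i)) (near-≤2 (toℕ i + toℕ i))
    lower (suc (suc j)) = ≤-refl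

  rep-attained : ∀ v p → ∃ λ y → part y ≡ p × dist v y ≡ rep v p
  rep-attained z     zero                = z , refl , refl
  rep-attained z     (suc zero)          = z₁ , refl , refl
  rep-attained z     (suc (suc j))       = w (suc j) , refl , refl
  rep-attained z₁    zero                = z , refl , refl
  rep-attained z₁    (suc zero)          = z₁ , refl , refl
  rep-attained z₁    (suc (suc j))       = w (suc j) , refl , refl
  rep-attained h     zero                = z , refl , refl
  rep-attained h     (suc zero)          = h , refl , refl
  rep-attained h     (suc (suc j))       = w (suc j) , refl , refl
  rep-attained h′    zero                = z , refl , refl
  rep-attained h′    (suc zero)          = h′ , refl , refl
  rep-attained h′    (suc (suc j))       = w (suc j) , refl , refl
  rep-attained c     zero                = z , refl , refl
  rep-attained c     (suc zero)          = h′ , refl , refl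
  rep-attained c     (suc (suc zero))    = c , refl , refl
  rep-attained c     (suc (suc (suc j))) = w (suc (suc j)) , refl , refl
  rep-attained (w i) zero                = z , refl , refl
  rep-attained (w i) (suc j) with i ≟ᶠ j
  ... | yes refl = w i , refl , distʷ-refl i
  rep-attained (w i) (suc zero)          | no _   = h , refl , refl
  rep-attained (w i) (suc (suc zero))    | no _   = c , refl , refl
  rep-attained (w i) (suc (suc (suc j))) | no i≢j = w (suc (suc j)) , refl , distʷ-≢ i _ i≢j

  occ-rep : ∀ x v → occ G connected Π x v ≡ ∑ (δ x ∘ rep v)
  occ-rep x v = ∑-cong λ p → cong (δ x) (r≡ G connected Π v
    (λ y → subst (rep v (part y) ≤_) (sym (d≡dist v y)) (rep-lower v y))
    (λ q → let y , y∈q , eq = rep-attained v q in y , y∈q , trans (d≡dist v y) eq) p)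

  -- The number of 1s of each `wᵢ` and of `c`.

  over : ℕ → ℕ
  over s = δ 1 (near s)

  over-∸ : ∀ s → over s + (s ∸ suc m) ≡ s ∸ m
  over-∸ s with m <? s
  ... | yes m<s rewrite near-close m<s = sym (+-∸-assoc 1 m<s)
  ... | no  m≮s rewrite near-distant (≮⇒≥ m≮s) =
    trans (m≤n⇒m∸n≡0 (m≤n⇒m≤1+n (≮⇒≥ m≮s))) (sym (m≤n⇒m∸n≡0 (≮⇒≥ m≮s)))

  -- Telescoping: by `over-∸`, `over s` is the increment of `s ∸ suc m` from `s` to `suc s`. The
  -- lower boundary term stands on the left to avoid a subtraction.
  ∑-over : ∀ n i → ∑ {n} (λ j → over (i + toℕ j)) + (i ∸ suc m) ≡ i + n ∸ suc m
  ∑-over zero    i = cong (_∸ suc m) (sym (+-identityʳ i))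
  ∑-over (suc n) i = begin
    over (i + 0) + ∑ {n} (λ j → over (i + suc (toℕ j))) + (i ∸ suc m)
      ≡⟨ cong₂ (λ s S → over s + S + (i ∸ suc m)) (+-identityʳ i)
           (∑-cong {n} λ j → cong over (+-suc i (toℕ j))) ⟩
    over i + S + (i ∸ suc m)   ≡⟨ cong (_+ (i ∸ suc m)) (+-comm (over i) S) ⟩
    S + over i + (i ∸ suc m)   ≡⟨ +-assoc S (over i) _ ⟩
    S + (over i + (i ∸ suc m)) ≡⟨ cong (S +_) (over-∸ i) ⟩
    -- `i ∸ m` is `suc i ∸ suc m` by computation, as the induction hypothesis requires.
    S + (suc i ∸ suc m)        ≡⟨ ∑-over n (suc i) ⟩
    suc i + n ∸ suc m          ≡⟨ cong (_∸ suc m) (+-suc i n) ⟨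
    i + suc n ∸ suc m          ∎
    where
    open ≡-Reasoning
    S = ∑ {n} (λ j → over (suc i + toℕ j))

  -- The correction term for j = i moves to the left, so that the right-hand side
  -- depends on j only through i + j and through j being 0 or 1.
  ones-pointwise : ∀ i j →
    δ 1 (rep (w i) (suc j)) + δ (toℕ i) (toℕ j) * over (toℕ i + toℕ i) ≡
    over (toℕ i + toℕ j) + (δ 0 (toℕ j) * (1 ⊓ toℕ i) + δ 1 (toℕ j) * over (toℕ i + toℕ i))
  ones-pointwise i j with i ≟ᶠ j
  ones-pointwise zero .zero | yes refl = refl
  ones-pointwise (suc zero) .(suc zero) | yes refl = refl
  ones-pointwise i@(suc (suc _)) .i | yes refl
    rewrite δ-refl (toℕ i) = trans (+-identityʳ _) (sym (+-identityʳ _))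
  ones-pointwise i j | no i≢j rewrite δ-≢ (i≢j ∘ toℕ-injective) = off i j i≢j
    where
    off : ∀ i j → i ≢ j → δ 1 (repʷ i j) + 0 ≡
      over (toℕ i + toℕ j) + (δ 0 (toℕ j) * (1 ⊓ toℕ i) + δ 1 (toℕ j) * over (toℕ i + toℕ i))
    off zero zero 0≢0 = contradiction refl 0≢0
    off (suc i) zero _ rewrite near-+0 (suc i) = refl
    off i (suc zero) _ rewrite near-+1 i = refl
    off i (suc (suc j)) _ = refl

  -- Summed over `j`, `b` occurs once on each side and cancels: as the excluded term `j = i` and as
  -- the contribution of `c` in part 1. What remains is the threshold sum plus the 1 from part 0.
  ones-w : ∀ i → ∑ (δ 1 ∘ rep (w i)) ≡ toℕ i
  ones-w i = +-cancelʳ-≡ (over (toℕ i + toℕ i)) _ _ (begin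
    O + b ≡⟨ cong (O +_) (∑-δ-* {m} i b) ⟨
    O + ∑ {m} (λ j → δ (toℕ i) (toℕ j) * b)
      ≡⟨ ∑-+ {m} (λ j → δ 1 (rep (w i) (suc j))) (λ j → δ (toℕ i) (toℕ j) * b) ⟨
    ∑ {m} (λ j → δ 1 (rep (w i) (suc j)) + δ (toℕ i) (toℕ j) * b)
      ≡⟨ ∑-cong (ones-pointwise i) ⟩
    ∑ {m} (λ j → over (toℕ i + toℕ j) + (δ 0 (toℕ j) * s + δ 1 (toℕ j) * b))
      ≡⟨ trans (∑-+ {m} (λ j → over (toℕ i + toℕ j)) (λ j → δ 0 (toℕ j) * s + δ 1 (toℕ j) * b))
           (cong (T₀ +_) (∑-+ {m} (λ j → δ 0 (toℕ j) * s) (λ j → δ 1 (toℕ j) * b))) ⟩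
    T₀ + (∑ {m} (λ j → δ 0 (toℕ j) * s) + ∑ {m} (λ j → δ 1 (toℕ j) * b))
      ≡⟨ cong₂ (λ x y → T₀ + (x + y)) (∑-δ-* {m} zero s) (∑-δ-* {m} (suc zero) b) ⟩
    T₀ + (s + b) ≡⟨ +-assoc T₀ s b ⟨
    T₀ + s + b ≡⟨ cong (_+ b) (threshold i) ⟩
    toℕ i + b ∎)
    where
    open ≡-Reasoning
    b = over (toℕ i + toℕ i)
    s = 1 ⊓ toℕ i
    O = ∑ {m} (λ j → δ 1 (rep (w i) (suc j)))
    T₀ = ∑ {m} (λ j → over (toℕ i + toℕ j))
    threshold : ∀ i → ∑ {m} (λ j → over (toℕ i + toℕ j)) + (1 ⊓ toℕ i) ≡ toℕ i
    threshold i = begin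
      S + (1 ⊓ toℕ i)                     ≡⟨ cong (_+ (1 ⊓ toℕ i)) (+-identityʳ S) ⟨
      S + 0 + (1 ⊓ toℕ i)                 ≡⟨ cong (λ n → S + n + (1 ⊓ toℕ i))
        (m≤n⇒m∸n≡0 (m≤n⇒m≤1+n (<⇒≤ (toℕ<n i)))) ⟨
      S + (toℕ i ∸ suc m) + (1 ⊓ toℕ i)   ≡⟨ cong (_+ (1 ⊓ toℕ i)) (∑-over m (toℕ i)) ⟩
      (toℕ i + m ∸ suc m) + (1 ⊓ toℕ i)   ≡⟨ pred+1⊓ (toℕ i) ⟩
      toℕ i                               ∎
      where
      S = ∑ {m} (λ j → over (toℕ i + toℕ j))
      -- The threshold sum is the truncated predecessor of `n`, so the summand for part 0 restores
      -- `n`, also at 0.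
      pred+1⊓ : ∀ n → (n + m ∸ suc m) + (1 ⊓ n) ≡ n
      pred+1⊓ zero    = trans (+-identityʳ _) (m≤n⇒m∸n≡0 (n≤1+n m))
      pred+1⊓ (suc n) = trans (cong (_+ 1) (m+n∸n≡m n m)) (+-comm n 1)

  -- The vector of `c` begins 4, 1, 0, 2, where the 2 comes from `2 + 2 ≤ m`; only `suc a` entries
  -- are left.
  ones-c : ∑ (δ 1 ∘ rep c) < 3 + a
  ones-c = s≤s (s≤s (∑≤n {suc a} (λ j → δ 1 (rep c (4 ↑ʳ j))) λ j → δ-≤1 1 (rep c (4 ↑ʳ j))))

  -- Recovering a vertex from its numbers of 4s, 3s and 1s.

  four three one : V → ℕ
  four h′ = 1
  four c  = 1
  four _  = 0
  three z     = 3 + a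
  three (w _) = 1
  three _     = 0
  one z     = 1
  one z₁    = 1
  one h     = 3 + a
  one h′    = 3 + a
  one c     = ∑ (δ 1 ∘ rep c)
  one (w i) = toℕ i

  -- A 4 occurs only for `h′` and `c`, separated by their 1s. Otherwise several 3s mean `z`, one 3
  -- means `w i` with `i` the number of 1s, and no 3 leaves `z₁` with one 1 or `h` with more.
  decode : ℕ → ℕ → ℕ → ℕ
  decode 0 0             1 = 1
  decode 0 0             _ = 2
  decode 0 1             x = 5 + x
  decode 0 (suc (suc _)) _ = 0
  decode (suc _) _       x = if x <ᵇ 3 + a then 4 else 3

  decode-toℕ : ∀ v → decode (four v) (three v) (one v) ≡ toℕ v
  decode-toℕ z  = refl
  decode-toℕ z₁ = refl
  decode-toℕ h  = refl
  decode-toℕ h′ with 3 + a <ᵇ 3 + a in eq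
  ... | true  = contradiction (<ᵇ⇒< (3 + a) (3 + a) (subst T (sym eq) tt)) (n≮n (3 + a))
  ... | false = refl
  decode-toℕ c with one c <ᵇ 3 + a | <⇒<ᵇ ones-c
  ... | true  | _ = refl
  decode-toℕ (w i) = refl

  rep-w-≤2 : ∀ i j → rep (w i) (suc j) ≤ 2
  rep-w-≤2 i j with does (i ≟ᶠ j)
  ... | true  = z≤n
  ... | false = repʷ-≤2 i j

  occ-four : ∀ v → ∑ (δ 4 ∘ rep v) ≡ four v
  occ-four z     = ∑-zero {3 + a} λ _ → refl
  occ-four z₁    = ∑-zero {3 + a} λ _ → refl
  occ-four h     = ∑-zero {3 + a} λ _ → refl
  occ-four h′    = cong suc (∑-zero {3 + a} λ _ → refl)
  occ-four c     = cong suc (∑-zero {2 + a} λ j → δ-large {1} (near-≤2 (2 + toℕ j + (2 + toℕ j))))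
  occ-four (w i) = ∑-zero {m} λ j → δ-large {1} (rep-w-≤2 i j)

  occ-three : ∀ v → ∑ (δ 3 ∘ rep v) ≡ three v
  occ-three z     = trans (∑-const (3 + a) 1) (*-identityʳ (3 + a))
  occ-three z₁    = ∑-zero {3 + a} λ _ → refl
  occ-three h     = ∑-zero {3 + a} λ _ → refl
  occ-three h′    = ∑-zero {3 + a} λ _ → refl
  occ-three c     = ∑-zero {2 + a} λ j → δ-large {0} (near-≤2 (2 + toℕ j + (2 + toℕ j)))
  occ-three (w i) = cong suc (∑-zero {m} λ j → δ-large {0} (rep-w-≤2 i j))

  occ-one : ∀ v → ∑ (δ 1 ∘ rep v) ≡ one v
  occ-one z     = cong suc (∑-zero {3 + a} λ _ → refl)
  occ-one z₁    = cong suc (∑-zero {3 + a} λ _ → refl)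
  occ-one h     = trans (∑-const (3 + a) 1) (*-identityʳ (3 + a))
  occ-one h′    = trans (∑-const (3 + a) 1) (*-identityʳ (3 + a))
  occ-one c     = refl
  occ-one (w i) = ones-w i

  resolving : Resolving Π
  resolving u v u≢v perm = u≢v (toℕ-injective (begin
    toℕ u                               ≡⟨ decode-toℕ u ⟨
    decode (four u) (three u) (one u)
      ≡⟨ cong (λ x → decode x (three u) (one u)) (same 4 four occ-four) ⟩
    decode (four v) (three u) (one u)
      ≡⟨ cong₂ (decode (four v)) (same 3 three occ-three) (same 1 one occ-one) ⟩
    decode (four v) (three v) (one v)   ≡⟨ decode-toℕ v ⟩
    toℕ v                               ∎))
    where
    open ≡-Reasoning
    same : ∀ x (f : V → ℕ) → (∀ y → ∑ (δ x ∘ rep y) ≡ f y) → f u ≡ f v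
    same x f f≡ = begin
      f u                      ≡⟨ f≡ u ⟨
      ∑ (δ x ∘ rep u)            ≡⟨ occ-rep x u ⟨
      occ G connected Π x u    ≡⟨ occ-cong G connected Π {u} {v} perm x ⟩
      occ G connected Π x v    ≡⟨ occ-rep x v ⟩
      ∑ (δ x ∘ rep v)            ≡⟨ f≡ v ⟩
      f v                      ∎

  -- The lower bound on the number of parts.

  -- 2 ↑ʳ_ enumerates h, h′, c and all wᵢ, and 4 ↑ʳ_ only c and all wᵢ.
  w-ball : ∀ i y → dist (w i) (2 ↑ʳ y) ≤ 2
  w-ball i zero                = s≤s z≤n
  w-ball i (suc zero)          = s≤s z≤n
  w-ball i (suc (suc zero))    = near-≤2 (toℕ i + toℕ i)
  w-ball i (suc (suc (suc j))) = distʷ-≤2 i j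

  ball : ∀ x y → dist (4 ↑ʳ x) (2 ↑ʳ y) ≤ 2
  ball zero    zero                = ≤-refl
  ball zero    (suc zero)          = s≤s z≤n
  ball zero    (suc (suc zero))    = z≤n
  ball zero    (suc (suc (suc j))) = near-≤2 (toℕ j + toℕ j)
  ball (suc i) y                   = w-ball i y

  module _ {t} (Φ : Partition t) (Φ-resolving : Resolving Φ) where
    open Partition Φ using () renaming (part to φ)

    ρ : V → Fin t → ℕ
    ρ = r G connected Φ

    ones-of : V → ℕ
    ones-of = occ G connected Φ 1

    ρ-ball : ∀ x y → ρ (4 ↑ʳ x) (φ (2 ↑ʳ y)) ≤ 2
    ρ-ball x y = ≤-trans (r≤d G connected Φ (4 ↑ʳ x) (2 ↑ʳ y))
      (subst (_≤ 2) (sym (d≡dist (4 ↑ʳ x) (2 ↑ʳ y))) (ball x y))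

    -- Fails exactly for the parts contained in `{z, z₁}`.
    Meets : Fin t → Set
    Meets p = ∃ λ y → φ (2 ↑ʳ y) ≡ p

    meets? : ∀ p → Dec (Meets p)
    meets? p = any? λ y → φ (2 ↑ʳ y) ≟ᶠ p

    ρ-meets : ∀ x {p} → Meets p → ρ (4 ↑ʳ x) p ≤ 2
    ρ-meets x (y , refl) = ρ-ball x y

    -- Only `z` and `z₁` can lie in such a part, and all `wᵢ` have the same distances 3 and 2 to
    -- them. Exchanging `i` and `j` gives equality.
    ρ-misses : ∀ i j {p} → ¬ Meets p → ρ (w i) p ≤ ρ (w j) p
    ρ-misses i j {p} ¬meets = r-mono G connected Φ (w i) (w j) p λ
      { z  _ → same-dist z refl
      ; z₁ _ → same-dist z₁ refl
      ; (suc (suc y)) y∈p → contradiction (y , y∈p) ¬meets }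
      where
      same-dist : ∀ y → dist (w i) y ≡ dist (w j) y → d (w i) y ≤ d (w j) y
      same-dist y eq = ≤-reflexive (trans (d≡dist (w i) y) (trans eq (sym (d≡dist (w j) y))))

    ρ-misses-≥2 : ∀ i {p} → ¬ Meets p → 2 ≤ ρ (w i) p
    ρ-misses-≥2 i {p} ¬meets = r-greatest G connected Φ (w i) p λ
      { z  _ → subst (2 ≤_) (sym (d≡dist (w i) z)) (n≤1+n 2)
      ; z₁ _ → subst (2 ≤_) (sym (d≡dist (w i) z₁)) ≤-refl
      ; (suc (suc y)) y∈p → contradiction (y , y∈p) ¬meets }

    -- By pigeonhole two of the `n` vertices have equally many 1s; by `rₘₚ-↭` their multisets then
    -- coincide, against resolvability.
    collision : ∀ {n b} (f : Fin n → V) → (∀ {i j} → f i ≡ f j → i ≡ j) → b < n →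
      (∀ i → ones-of (f i) < b) →
      (∀ i j p → ρ (f i) p ≡ ρ (f j) p ⊎ (ρ (f i) p ≤ 2 × ρ (f j) p ≤ 2)) → ⊥
    collision f f-inj b<n ones< close =
      let i , j , i<j , eq = pigeonhole b<n (λ i → fromℕ< (ones< i)) in
      Φ-resolving (f i) (f j) (<ᶠ⇒≢ i<j ∘ f-inj)
        (rₘₚ-↭ G connected Φ (f i) (f j) (close i j)
          (fromℕ<-injective _ _ (ones< i) (ones< j) eq))

    w-close : ∀ i j q → ρ (w i) q ≡ ρ (w j) q ⊎ (ρ (w i) q ≤ 2 × ρ (w j) q ≤ 2)
    w-close i j q = [ (λ q∈ → inj₂ (ρ-meets (suc i) q∈ , ρ-meets (suc j) q∈))
                  , (λ q∉ → inj₁ (≤-antisym (ρ-misses i j q∉) (ρ-misses j i q∉))) ]′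
                  (toSum (meets? q))

    parts-≥ : suc m ≤ t
    parts-≥ = ≮⇒≥ λ t<1+m → [ all-meet t<1+m , some-miss t<1+m ∘ ¬∀⟶∃¬ t Meets meets? ]′
      (toSum (all? meets?))
      where
      all-meet : t < suc m → (∀ p → Meets p) → ⊥
      all-meet t<1+m meets = collision (4 ↑ʳ_) (λ {x} {y} → ↑ʳ-injective 4 x y) t<1+m
        (λ x → occ-1-< G connected Φ (4 ↑ʳ x))
        λ x y p → inj₂ (ρ-meets x (meets p) , ρ-meets y (meets p))

      some-miss : t < suc m → (∃ λ p → ¬ Meets p) → ⊥
      -- The vertex `c` is left out, since its distances to `z` and `z₁` differ from those of the
      -- `wᵢ`. The missed part lowers the bound to `pred t`, which makes up for this.
      some-miss t<1+m (p , ¬meets) = collision {b = pred t} (5 ↑ʳ_)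
        (λ {i} {j} → ↑ʳ-injective 5 i j)
        (subst (_≤ m) (sym 1+pred) (s≤s⁻¹ t<1+m))
        (λ i → s≤s⁻¹ (subst (suc (suc (ones-of (w i))) ≤_) (sym 1+pred)
          (occ-1-far G connected Φ (w i) p (ρ-misses-≥2 i ¬meets))))
        w-close
        where
        1+pred : suc (pred t) ≡ t
        1+pred = suc-pred t {{nonZeroIndex p}}

  mpd : mpd≡ suc m
  mpd = (Π , resolving) , λ _ (Φ , Φ-resolving) → parts-≥ Φ Φ-resolving

theorem2p3 : (k : ℕ) → 6 ≤ k →
    Σ[ G ∈ Graph ] Σ[ connected ∈ Graph.Connected G ] Graph.Metric.mpd≡_ G connected k
theorem2p3 k 6≤k = G , connected , subst mpd≡_ (m+[n∸m]≡n 6≤k) mpd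
  where
  -- With this argument `suc m` computes to `6 + (k ∸ 6)`, which is `k`.
  open Construction (suc (k ∸ 6))
  open Graph.Metric G connected
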